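{- Let $V$ be a finite set with $|V| = n$, and suppose that $\mathcal G_1 \subset \mathcal G_2 \subset \mathcal G_3 \subset \binom{V}{2}$ and that $\mathcal G_1, \mathcal G_2, \mathcal G_3$ are rainbow triangle-free (RBT-free). Then $$|\mathcal G_1|\,|\mathcal G_2|\,|\mathcal G_3| \leq \lfloor n^2/4 \rfloor^3.$$
   Context: A graph on the vertex set $V$ is identified with its edge set, a subset of $\binom{V}{2}$ (the 2-element subsets of $V$), and $|\mathcal G|$ denotes the number of edges. A triangle is the set of three edges $\binom{T}{2}$ for some 3-element set $T \subset V$. Three graphs $\mathcal G_1, \mathcal G_2, \mathcal G_3 \subset \binom{V}{2}$ are called rainbow triangle-free (RBT-free) if there do not exist edges $E_1 \in \mathcal G_1$, $E_2 \in \mathcal G_2$, $E_3 \in \mathcal G_3$ such that $\{E_1, E_2, E_3\}$ is a triangle. -}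

module Defs where

open import Data.List.Base using (List; []; _∷_; length)
import Data.List.Membership.Setoid as ListMembership
import Data.List.Relation.Binary.Subset.Setoid as ListSubset
import Data.List.Relation.Unary.Unique.Setoid as ListUnique
open import Data.Nat.Base using (ℕ)
open import Data.Product.Base using (_×_; _,_; swap; ∃-syntax)
open import Data.Vec.Base using (Vec)
open import Data.Vec.Membership.Propositional using () renaming (_∈_ to _∈ᵛ_)
open import Data.Vec.Relation.Unary.Unique.Propositional using (Unique)
open import Function.Base using (id)
open import Function.Bundles using (_⇔_)
open import Level using (Level)
open import Relation.Binary.Bundles using (Setoid)
open import Relation.Nullary.Negation.Core using (¬_)

private
  variable
    a : Level
    V : Set a
    k l : ℕ

-- An element of binom(V, k), given by listing its k distinct elements.  The
-- order of the listing is irrelevant: k-subsets are always compared with _≈_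
-- below, never with _≡_.
record KSubset (V : Set a) (k : ℕ) : Set a where
  constructor kSubset
  field
    elements : Vec V k
    distinct : Unique elements

open KSubset public

infix 4 _⊆ₖ_ _≈_

_⊆ₖ_ : {V : Set a} → KSubset V k → KSubset V l → Set a
S ⊆ₖ T = ∀ {x} → x ∈ᵛ elements S → x ∈ᵛ elements T

_≈_ : {V : Set a} → KSubset V k → KSubset V k → Set a
S ≈ T = S ⊆ₖ T × T ⊆ₖ S

kSubsetSetoid : Set a → ℕ → Setoid a a
kSubsetSetoid V k = record
  { Carrier       = KSubset V k
  ; _≈_           = _≈_
  ; isEquivalence = record
    { refl  = id , id
    ; sym   = swap
    ; trans = λ (p , p′) (q , q′) → (λ x∈ → q (p x∈)) , (λ x∈ → p′ (q′ x∈))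
    }
  }

Edge : Set a → Set a
Edge V = KSubset V 2

edgeSetoid : Set a → Setoid a a
edgeSetoid V = kSubsetSetoid V 2

-- A finite subset of binom(V, 2).  Uniqueness is up to _≈_, so the length of
-- the list is the number of edges.
record Graph (V : Set a) : Set a where
  constructor graph
  field
    edges  : List (Edge V)
    unique : ListUnique.Unique (edgeSetoid V) edges

open Graph public

infix 4 _∈_ _⊆_

_∈_ : {V : Set a} → Edge V → Graph V → Set a
_∈_ {V = V} E G = E ListMem.∈ edges G
  where module ListMem = ListMembership (edgeSetoid V)

_⊆_ : {V : Set a} → Graph V → Graph V → Set a
_⊆_ {V = V} G H = edges G ListSub.⊆ edges H
  where module ListSub = ListSubset (edgeSetoid V)

∣_∣ : Graph V → ℕ
∣ G ∣ = length (edges G)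

-- {E₁, E₂, E₃} = binom(T, 2) for some 3-element set T; an edge belongs to
-- binom(T, 2) exactly when it is contained in T.
IsTriangle : {V : Set a} → Edge V → Edge V → Edge V → Set a
IsTriangle {V = V} E₁ E₂ E₃ =
  ∃[ T ] ((E : Edge V) →
    (E ListMem.∈ (E₁ ∷ E₂ ∷ E₃ ∷ [])) ⇔ (_⊆ₖ_ {l = 3} E T))
  where module ListMem = ListMembership (edgeSetoid V)

RainbowTriangleFree : {V : Set a} → Graph V → Graph V → Graph V → Set a
RainbowTriangleFree G₁ G₂ G₃ =
  ¬ (∃[ E₁ ] ∃[ E₂ ] ∃[ E₃ ]
      (E₁ ∈ G₁ × E₂ ∈ G₂ × E₃ ∈ G₃ × IsTriangle E₁ E₂ E₃))

{-# OPTIONS --safe #-}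
-- Let M be a matching of s edges in G₁ that no path of length 1 or 3 augments,
-- and let R be the set of unmatched vertices.  If uv ∈ M, then for every x at most one
-- of ux ∈ G₂ and vx ∈ G₃ holds, so u and v have at most |L| edges in G₁, and at
-- most 2 |L| in G₂ and G₃ together, towards any set L.  No G₁-edge lies inside R,
-- and for each uv ∈ M at most one of u, v has G₁-neighbours in R.  Let k be the
-- largest number of such neighbours and q = |R| − k.  A G₁-neighbourhood is
-- independent in G₃, hence
--   |G₁| ≤ s² + s k,   |G₂| + |G₃| + q ≤ 2 s² + 2 s (k + q) + 2 k q + q².
-- If q < 3 (s + 1) the two bounds add up to at most 3 ⌊n²/4⌋ and AM-GM applies;
-- otherwise s ≤ n/5, and the product is smaller by a constant factor.
module Submission where

open import Defs
open import Data.Empty using (⊥)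
open import Data.Fin.Base using (Fin)
import Data.Fin.Properties as Fin
open import Data.List.Base using (List; []; _∷_; _++_; length; map; filter; allFin)
open import Data.List.Membership.Propositional using (find; lose) renaming (_∈_ to _∈ˡ_)
open import Data.List.Membership.Propositional.Properties
  using (∈-∃++; ∈-map⁺; ∈-filter⁺; ∈-++⁺ˡ; ∈-++⁺ʳ; ∈-allFin)
import Data.List.Membership.Setoid as ListMembership
open import Data.List.Properties
  using (filter-none; filter-++; length-filter;
         length-++; length-map; length-removeAt′; length-tabulate)
open import Data.List.Relation.Binary.Permutation.Propositional
  using (_↭_; ↭-refl; ↭-trans; ↭-prep; ↭-swap)
open import Data.List.Relation.Binary.Permutation.Propositional.Properties
  using (Any-resp-↭; ∈-resp-↭; ↭-length; shift; ++⁺ˡ)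
open import Data.List.Relation.Unary.All as All using (All; []; _∷_)
open import Data.List.Relation.Unary.All.Properties using (¬Any⇒All¬)
open import Data.List.Relation.Unary.AllPairs using (AllPairs; []; _∷_)
open import Data.List.Relation.Unary.Any as Any using (Any; here; there; any?; satisfied; _─_)
open import Data.List.Relation.Unary.Any.Properties using (lookup-result)
open import Data.Nat.Base
open import Data.Nat.DivMod using (_/_; m*n/n≡m; /-monoˡ-≤)
open import Data.Nat.Induction using (<-wellFounded)
open import Data.Nat.Properties hiding (_≟_)
open import Data.Nat.Tactic.RingSolver using (solve-∀)
open import Data.Product.Base using (_×_; _,_; proj₁; proj₂; uncurry; ∃-syntax)
open import Data.Sum.Base as Sum using (_⊎_; inj₁; inj₂)
open import Data.Vec.Base using ([]; _∷_)
open import Data.Vec.Membership.DecPropositional using () renaming (_∈?_ to mem?)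
open import Data.Vec.Membership.Propositional using () renaming (_∈_ to _∈ᵛ_)
open import Data.Vec.Relation.Unary.All using ([]; _∷_)
open import Data.Vec.Relation.Unary.AllPairs using ([]; _∷_)
open import Data.Vec.Relation.Unary.Any using (here; there)
open import Function.Base using (_∘_; id)
open import Function.Bundles using (_↔_; mk⇔; module Inverse)
open import Function.Properties.Inverse using (↔⇒↣)
open import Induction.WellFounded using (Acc; acc)
open import Level using (Level)
open import Relation.Binary.Core using (REL; Rel)
open import Relation.Binary.Definitions
  using (DecidableEquality; Symmetric) renaming (Decidable to Decidable₂)
open import Relation.Binary.PropositionalEquality
  using (_≡_; _≢_; refl; sym; trans; cong; cong₂; subst; subst₂)
open import Relation.Nullary.Decidable using (Dec; yes; no; ¬?; _×-dec_; via-injection)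
open import Relation.Nullary.Negation.Core using (¬_; contradiction)
open import Relation.Unary using (Pred; Decidable)
open import Relation.Unary.Properties using (∅?)
open ≤-Reasoning

private
  variable
    a b ℓ ℓ′ : Level
    A : Set a
    B : Set b
    V : Set a

-- Numerical inequalities

2ab≤a²+b² : ∀ a b → 2 * (a * b) ≤ a * a + b * b
2ab≤a²+b² a b with ≤-total a b
... | inj₁ a≤b with d , refl ← m≤n⇒∃[o]m+o≡n a≤b =
  ≤-trans (m≤m+n _ (d * d)) (≤-reflexive (eq a d))
  where
  eq : ∀ a d → 2 * (a * (a + d)) + d * d ≡ a * a + (a + d) * (a + d)
  eq = solve-∀
... | inj₂ b≤a with d , refl ← m≤n⇒∃[o]m+o≡n b≤a =
  ≤-trans (m≤m+n _ (d * d)) (≤-reflexive (eq b d))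
  where
  eq : ∀ b d → 2 * ((b + d) * b) + d * d ≡ (b + d) * (b + d) + b * b
  eq = solve-∀

4ab≤[a+b]² : ∀ a b → 4 * (a * b) ≤ (a + b) * (a + b)
4ab≤[a+b]² a b = begin
  4 * (a * b)                       ≡⟨ split a b ⟩
  2 * (a * b) + 2 * (a * b)         ≤⟨ +-monoˡ-≤ _ (2ab≤a²+b² a b) ⟩
  a * a + b * b + 2 * (a * b)       ≡⟨ square a b ⟩
  (a + b) * (a + b)                 ∎
  where
  split : ∀ a b → 4 * (a * b) ≡ 2 * (a * b) + 2 * (a * b)
  split = solve-∀
  square : ∀ a b → a * a + b * b + 2 * (a * b) ≡ (a + b) * (a + b)
  square = solve-∀

cube-mono-≤ : ∀ {a b} → a ≤ b → a * a * a ≤ b * b * b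
cube-mono-≤ a≤b = *-mono-≤ (*-mono-≤ a≤b a≤b) a≤b

-- 4 (x + y)³ − 27 x y² = (y − 2 x)² (4 y + x), with the subtractions moved to
-- the other side.
27xy²≤4[x+y]³ : ∀ x y → 27 * (x * (y * y)) ≤ 4 * ((x + y) * (x + y) * (x + y))
27xy²≤4[x+y]³ x y = +-cancelʳ-≤ _ _ _ (begin
  27 * (x * (y * y)) + (4 * y + x) * (2 * (y * (2 * x)))
    ≤⟨ +-monoʳ-≤ (27 * (x * (y * y))) (*-monoʳ-≤ (4 * y + x) (2ab≤a²+b² y (2 * x))) ⟩
  27 * (x * (y * y)) + (4 * y + x) * (y * y + 2 * x * (2 * x))
    ≡⟨ eq x y ⟩
  4 * ((x + y) * (x + y) * (x + y)) + (4 * y + x) * (2 * (y * (2 * x))) ∎)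
  where
  eq : ∀ x y → 27 * (x * (y * y)) + (4 * y + x) * (y * y + 2 * x * (2 * x))
             ≡ 4 * ((x + y) * (x + y) * (x + y)) + (4 * y + x) * (2 * (y * (2 * x)))
  eq = solve-∀

-- AM-GM for the three numbers x, y/2, y/2, cleared of denominators; the extreme case is x = F, y =
-- 2F.
amgm : ∀ {x y F} → x + y ≤ 3 * F → x * (y * y) ≤ 4 * (F * F * F)
amgm {x} {y} {F} x+y≤3F = *-cancelˡ-≤ 27 (begin
  27 * (x * (y * y))                      ≤⟨ 27xy²≤4[x+y]³ x y ⟩
  4 * ((x + y) * (x + y) * (x + y))       ≤⟨ *-monoʳ-≤ 4 (cube-mono-≤ x+y≤3F) ⟩
  4 * (3 * F * (3 * F) * (3 * F))         ≡⟨ eq F ⟩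
  27 * (4 * (F * F * F))                  ∎)
  where
  eq : ∀ F → 4 * (3 * F * (3 * F) * (3 * F)) ≡ 27 * (4 * (F * F * F))
  eq = solve-∀

-- For q ≥ 3 the right side is at least 4 q (q + 1), and 4 q ≥ 9; the values q = 1 and q = 2 rely on
-- s ≥ 2. The 9 becomes, after division by 3, the allowance for rounding in m² ≤ 1 + 4 f.
4q²+9≤12qs : ∀ q s → 1 ≤ q → 2 ≤ s → q < 3 * s → 4 * (q * q) + 9 ≤ 12 * (q * s)
4q²+9≤12qs 1 s _ 2≤s _ = begin
  13              ≤⟨ m≤m+n 13 11 ⟩
  24              ≤⟨ *-monoʳ-≤ 12 (*-monoʳ-≤ 1 2≤s) ⟩
  12 * (1 * s)    ∎
4q²+9≤12qs 2 s _ 2≤s _ = begin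
  25              ≤⟨ m≤m+n 25 23 ⟩
  48              ≤⟨ *-monoʳ-≤ 12 (*-monoʳ-≤ 2 2≤s) ⟩
  12 * (2 * s)    ∎
4q²+9≤12qs q@(suc (suc (suc r))) s _ _ q<3s = begin
  4 * (q * q) + 9               ≤⟨ m≤m+n _ (4 * r + 3) ⟩
  4 * (q * q) + 9 + (4 * r + 3) ≡⟨ eq₁ r ⟩
  4 * (q * suc q)               ≤⟨ *-monoʳ-≤ 4 (*-monoʳ-≤ q q<3s) ⟩
  4 * (q * (3 * s))             ≡⟨ eq₂ q s ⟩
  12 * (q * s)                  ∎
  where
  eq₁ : ∀ r → 4 * ((3 + r) * (3 + r)) + 9 + (4 * r + 3) ≡ 4 * ((3 + r) * (4 + r))
  eq₁ = solve-∀
  eq₂ : ∀ q s → 4 * (q * (3 * s)) ≡ 12 * (q * s)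
  eq₂ = solve-∀

-- Rests on 12 k² + 4 q² − 3 (k + q)² = (3 k − q)².
[k+q]²+3≤4[k²+qs] : ∀ k q s → 1 ≤ q → 2 ≤ s → q < 3 * s →
                    (k + q) * (k + q) + 3 ≤ 4 * (k * k + q * s)
[k+q]²+3≤4[k²+qs] k q s 1≤q 2≤s q<3s = *-cancelˡ-≤ 3 (begin
  3 * ((k + q) * (k + q) + 3)
    ≡⟨ eq₁ k q ⟩
  2 * (3 * k * q) + (3 * (k * k) + 3 * (q * q) + 9)
    ≤⟨ +-monoˡ-≤ _ (2ab≤a²+b² (3 * k) q) ⟩
  3 * k * (3 * k) + q * q + (3 * (k * k) + 3 * (q * q) + 9)
    ≡⟨ eq₂ k q ⟩
  12 * (k * k) + (4 * (q * q) + 9)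
    ≤⟨ +-monoʳ-≤ (12 * (k * k)) (4q²+9≤12qs q s 1≤q 2≤s q<3s) ⟩
  12 * (k * k) + 12 * (q * s)
    ≡⟨ eq₃ k q s ⟩
  3 * (4 * (k * k + q * s)) ∎)
  where
  eq₁ : ∀ k q → 3 * ((k + q) * (k + q) + 3) ≡ 2 * (3 * k * q) + (3 * (k * k) + 3 * (q * q) + 9)
  eq₁ = solve-∀
  eq₂ : ∀ k q → 3 * k * (3 * k) + q * q + (3 * (k * k) + 3 * (q * q) + 9)
              ≡ 12 * (k * k) + (4 * (q * q) + 9)
  eq₂ = solve-∀
  eq₃ : ∀ k q s → 12 * (k * k) + 12 * (q * s) ≡ 3 * (4 * (k * k + q * s))
  eq₃ = solve-∀

-- Four times the left side splits as m² + 3 m² with m = k + q. The preceding inequality bounds the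
-- first part with 3 to spare, exactly what 3 m² ≤ 3 + 12 f loses. For q = 0 the term k² alone
-- suffices.
[k+q]²≤k²+qs+3f : ∀ k q s f → 2 ≤ s → q < 3 * s → (k + q) * (k + q) ≤ 1 + 4 * f →
                  (k + q) * (k + q) ≤ k * k + q * s + 3 * f
[k+q]²≤k²+qs+3f k zero s f _ _ _ = begin
  (k + 0) * (k + 0)       ≡⟨ cong (λ m → m * m) (+-identityʳ k) ⟩
  k * k                   ≤⟨ m≤m+n _ _ ⟩
  k * k + 0               ≤⟨ m≤m+n _ _ ⟩
  k * k + 0 + 3 * f       ∎
[k+q]²≤k²+qs+3f k q@(suc _) s f 2≤s q<3s m²≤1+4f = *-cancelˡ-≤ 4 (+-cancelʳ-≤ 3 _ _ (begin
  4 * m² + 3                        ≡⟨ eq₁ m² ⟩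
  (m² + 3) + 3 * m²                 ≤⟨ +-mono-≤ ([k+q]²+3≤4[k²+qs] k q s (s≤s z≤n) 2≤s q<3s)
                                                (*-monoʳ-≤ 3 m²≤1+4f) ⟩
  4 * (k * k + q * s) + 3 * (1 + 4 * f) ≡⟨ eq₂ (k * k + q * s) f ⟩
  4 * (k * k + q * s + 3 * f) + 3   ∎))
  where
  m² = (k + q) * (k + q)
  eq₁ : ∀ a → 4 * a + 3 ≡ (a + 3) + 3 * a
  eq₁ = solve-∀
  eq₂ : ∀ a f → 4 * a + 3 * (1 + 4 * f) ≡ 4 * (a + 3 * f) + 3
  eq₂ = solve-∀

-- From the two edge bounds to the product bound

module _ {s k q Y : ℕ} (Y-bound : Y + q ≤ 2 * (s * s) + 2 * (s * (k + q)) + (2 * (k * q) + q * q)) where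

  private
    -- In the application `s` is the size of the matching, `m` the number of unmatched vertices, `n`
    -- that of all vertices, `X` the bound on |G₁|, and `Y` is |G₂| + |G₃|.
    m n X : ℕ
    m = k + q
    n = 2 * s + m
    X = s * (s + k)

  -- The two bounds add up to 3 (s² + s m) + m² with k² + q (s + 1) to spare, and that reserve
  -- covers the excess of m² over 3 f. The summand `q` in `Y-bound` is what turns q s into q (s +
  -- 1).
  X+Y≤3F : ∀ {f} → 1 ≤ s → q < 3 * suc s → m * m ≤ 1 + 4 * f →
           X + Y ≤ 3 * (s * s + s * m + f)
  X+Y≤3F {f} 1≤s q<3S m²≤1+4f = +-cancelʳ-≤ (k * k + q * suc s) _ _ (begin
    X + Y + (k * k + q * suc s)
      ≡⟨ eq₁ s k q Y ⟩
    (Y + q) + (s * s + s * k + s * q + k * k)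
      ≤⟨ +-monoˡ-≤ _ Y-bound ⟩
    2 * (s * s) + 2 * (s * (k + q)) + (2 * (k * q) + q * q) + (s * s + s * k + s * q + k * k)
      ≡⟨ eq₂ s k q ⟩
    3 * (s * s + s * m) + m * m
      ≤⟨ +-monoʳ-≤ (3 * (s * s + s * m)) ([k+q]²≤k²+qs+3f k q (suc s) f (s≤s 1≤s) q<3S m²≤1+4f) ⟩
    3 * (s * s + s * m) + (k * k + q * suc s + 3 * f)
      ≡⟨ eq₃ (s * s + s * m) (k * k + q * suc s) f ⟩
    3 * (s * s + s * m + f) + (k * k + q * suc s) ∎)
    where
    eq₁ : ∀ s k q Y → s * (s + k) + Y + (k * k + q * (1 + s)) ≡ (Y + q) + (s * s + s * k + s * q + k * k)
    eq₁ = solve-∀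
    eq₂ : ∀ s k q → 2 * (s * s) + 2 * (s * (k + q)) + (2 * (k * q) + q * q) + (s * s + s * k + s * q + k * k)
                  ≡ 3 * (s * s + s * (k + q)) + (k + q) * (k + q)
    eq₂ = solve-∀
    eq₃ : ∀ a b f → 3 * a + (b + 3 * f) ≡ 3 * (a + f) + b
    eq₃ = solve-∀

  Y+k²-bound : Y + k * k ≤ 2 * (s * s) + 2 * (s * m) + m * m
  Y+k²-bound = begin
    Y + k * k                ≤⟨ +-monoˡ-≤ (k * k) (m≤m+n Y q) ⟩
    Y + q + k * k            ≤⟨ +-monoˡ-≤ (k * k) Y-bound ⟩
    2 * (s * s) + 2 * (s * (k + q)) + (2 * (k * q) + q * q) + k * k
                             ≡⟨ eq s k q ⟩
    2 * (s * s) + 2 * (s * m) + m * m ∎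
    where
    eq : ∀ s k q → 2 * (s * s) + 2 * (s * (k + q)) + (2 * (k * q) + q * q) + k * k
                 ≡ 2 * (s * s) + 2 * (s * (k + q)) + (k + q) * (k + q)
    eq = solve-∀

  -- The constants come from the boundary case m = 3 s, where n = 5 s and the bound on `Y` is 17 s².
  -- Writing m = 3 s + r leaves a difference with nonnegative coefficients only.
  125sY≤17n³ : 3 * s ≤ m → 125 * (s * Y) ≤ 17 * (n * n * n)
  125sY≤17n³ 3s≤m with r , 3s+r≡m ← m≤n⇒∃[o]m+o≡n 3s≤m = begin
    125 * (s * Y)
      ≤⟨ *-monoʳ-≤ 125 (*-monoʳ-≤ s (≤-trans (m≤m+n Y (k * k)) Y+k²-bound)) ⟩
    125 * (s * (2 * (s * s) + 2 * (s * m) + m * m))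
      ≤⟨ polynomial m 3s+r≡m ⟩
    17 * (n * n * n) ∎
    where
    eq : ∀ s r → 125 * (s * (2 * (s * s) + 2 * (s * (3 * s + r)) + (3 * s + r) * (3 * s + r)))
               + (275 * (s * s * r) + 130 * (s * r * r) + 17 * (r * r * r))
               ≡ 17 * ((2 * s + (3 * s + r)) * (2 * s + (3 * s + r)) * (2 * s + (3 * s + r)))
    eq = solve-∀
    polynomial : ∀ m → 3 * s + r ≡ m → 125 * (s * (2 * (s * s) + 2 * (s * m) + m * m))
                                     ≤ 17 * ((2 * s + m) * (2 * s + m) * (2 * s + m))
    polynomial _ refl = ≤-trans (m≤m+n _ _) (≤-reflexive (eq s r))

  -- A large `k` raises s + k but lowers the bound on `Y` by k², and 4 k n ≤ 4 k² + n² charges the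
  -- gain to that loss. A bound on the sum is the form from which the product (s + k) Y is bounded
  -- next.
  4Y+4[s+k]n≤5n² : 4 * Y + 4 * ((s + k) * n) ≤ 5 * (n * n)
  4Y+4[s+k]n≤5n² = begin
    4 * Y + 4 * ((s + k) * n)
      ≡⟨ eq₁ s k n Y ⟩
    4 * Y + 2 * (2 * k * n) + 4 * (s * n)
      ≤⟨ +-monoˡ-≤ _ (+-monoʳ-≤ (4 * Y) (2ab≤a²+b² (2 * k) n)) ⟩
    4 * Y + (2 * k * (2 * k) + n * n) + 4 * (s * n)
      ≡⟨ eq₂ s k n Y ⟩
    4 * (Y + k * k) + (n * n + 4 * (s * n))
      ≤⟨ +-monoˡ-≤ _ (*-monoʳ-≤ 4 Y+k²-bound) ⟩
    4 * (2 * (s * s) + 2 * (s * m) + m * m) + (n * n + 4 * (s * n))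
      ≤⟨ m≤m+n _ (4 * (s * m)) ⟩
    4 * (2 * (s * s) + 2 * (s * m) + m * m) + (n * n + 4 * (s * n)) + 4 * (s * m)
      ≡⟨ eq₃ s m ⟩
    5 * (n * n) ∎
    where
    eq₁ : ∀ s k n Y → 4 * Y + 4 * ((s + k) * n) ≡ 4 * Y + 2 * (2 * k * n) + 4 * (s * n)
    eq₁ = solve-∀
    eq₂ : ∀ s k n Y → 4 * Y + (2 * k * (2 * k) + n * n) + 4 * (s * n)
                    ≡ 4 * (Y + k * k) + (n * n + 4 * (s * n))
    eq₂ = solve-∀
    eq₃ : ∀ s m → 4 * (2 * (s * s) + 2 * (s * m) + m * m)
                + ((2 * s + m) * (2 * s + m) + 4 * (s * (2 * s + m))) + 4 * (s * m)
                ≡ 5 * ((2 * s + m) * (2 * s + m))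
    eq₃ = solve-∀

  64n[s+k]Y≤25n⁴ : 64 * (n * ((s + k) * Y)) ≤ 25 * (n * n * (n * n))
  64n[s+k]Y≤25n⁴ = begin
    64 * (n * ((s + k) * Y))
      ≡⟨ eq₁ n (s + k) Y ⟩
    4 * (4 * Y * (4 * ((s + k) * n)))
      ≤⟨ 4ab≤[a+b]² (4 * Y) (4 * ((s + k) * n)) ⟩
    (4 * Y + 4 * ((s + k) * n)) * (4 * Y + 4 * ((s + k) * n))
      ≤⟨ *-mono-≤ 4Y+4[s+k]n≤5n² 4Y+4[s+k]n≤5n² ⟩
    5 * (n * n) * (5 * (n * n))
      ≡⟨ eq₂ n ⟩
    25 * (n * n * (n * n)) ∎
    where
    eq₁ : ∀ n y Y → 64 * (n * (y * Y)) ≡ 4 * (4 * Y * (4 * (y * n)))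
    eq₁ = solve-∀
    eq₂ : ∀ n → 5 * (n * n) * (5 * (n * n)) ≡ 25 * (n * n * (n * n))
    eq₂ = solve-∀

  -- X Y² factors as (s Y) ((s + k) Y), so the two preceding estimates multiply, and 125 · 64 / 25 =
  -- 320.
  320XY²≤17n⁶ : 1 ≤ s → 3 * s ≤ m → 320 * (X * (Y * Y)) ≤ 17 * (n * n * (n * n) * (n * n))
  320XY²≤17n⁶ 1≤s 3s≤m = *-cancelˡ-≤ (25 * n) {{>-nonZero 1≤25n}} (begin
    25 * n * (320 * (X * (Y * Y)))
      ≡⟨ eq₁ s k n Y ⟩
    125 * (s * Y) * (64 * (n * ((s + k) * Y)))
      ≤⟨ *-mono-≤ (125sY≤17n³ 3s≤m) 64n[s+k]Y≤25n⁴ ⟩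
    17 * (n * n * n) * (25 * (n * n * (n * n)))
      ≡⟨ eq₂ n ⟩
    25 * n * (17 * (n * n * (n * n) * (n * n))) ∎)
    where
    1≤25n : 1 ≤ 25 * n
    1≤25n = begin
      1       ≤⟨ 1≤s ⟩
      s       ≤⟨ m≤m+n s _ ⟩
      2 * s   ≤⟨ m≤m+n (2 * s) m ⟩
      n       ≤⟨ m≤m+n n _ ⟩
      25 * n  ∎
    eq₁ : ∀ s k n Y → 25 * n * (320 * (s * (s + k) * (Y * Y))) ≡ 125 * (s * Y) * (64 * (n * ((s + k) * Y)))
    eq₁ = solve-∀
    eq₂ : ∀ n → 17 * (n * n * n) * (25 * (n * n * (n * n))) ≡ 25 * n * (17 * (n * n * (n * n) * (n * n)))
    eq₂ = solve-∀

  -- With n² close to 4 F the previous estimate gives about 3.4 F³, which leaves room for rounding: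
  -- F ≥ 5 turns n² ≤ 1 + 4 F into 5 n² ≤ 21 F, and 17 · 21³ = 157437 is still below 160000.
  XY²≤4F³-large : ∀ {F} → 1 ≤ s → 3 * suc s ≤ q → n * n ≤ 1 + 4 * F →
                  X * (Y * Y) ≤ 4 * (F * F * F)
  XY²≤4F³-large {F} 1≤s 3S≤q n²≤1+4F = *-cancelˡ-≤ (125 * 320) (begin
    125 * 320 * (X * (Y * Y))                     ≡⟨ *-assoc 125 320 (X * (Y * Y)) ⟩
    125 * (320 * (X * (Y * Y)))                   ≤⟨ *-monoʳ-≤ 125 (320XY²≤17n⁶ 1≤s (≤-trans 3s≤q (m≤n+m q k))) ⟩
    125 * (17 * (n * n * (n * n) * (n * n)))      ≡⟨ eq₁ (n * n) ⟩
    17 * (5 * (n * n) * (5 * (n * n)) * (5 * (n * n)))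
                                                  ≤⟨ *-monoʳ-≤ 17 (cube-mono-≤ 5n²≤21F) ⟩
    17 * (21 * F * (21 * F) * (21 * F))           ≡⟨ eq₂ F ⟩
    157437 * (F * F * F)                          ≤⟨ *-monoˡ-≤ (F * F * F) (m≤m+n 157437 2563) ⟩
    160000 * (F * F * F)                          ≡⟨ *-assoc 40000 4 (F * F * F) ⟩
    125 * 320 * (4 * (F * F * F))                 ∎)
    where
    3s≤q : 3 * s ≤ q
    3s≤q = ≤-trans (*-monoʳ-≤ 3 (n≤1+n s)) 3S≤q
    5≤n : 5 ≤ n
    5≤n = begin
      5       ≤⟨ m≤m+n 5 1 ⟩
      3 * 2   ≤⟨ *-monoʳ-≤ 3 (s≤s 1≤s) ⟩
      3 * suc s ≤⟨ 3S≤q ⟩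
      q       ≤⟨ m≤n+m q k ⟩
      m       ≤⟨ m≤n+m m (2 * s) ⟩
      n       ∎
    5≤F : 5 ≤ F
    5≤F = *-cancelˡ-≤ 4 (≤-trans (m≤m+n 20 4) (s≤s⁻¹ (≤-trans (*-mono-≤ 5≤n 5≤n) n²≤1+4F)))
    5n²≤21F : 5 * (n * n) ≤ 21 * F
    5n²≤21F = begin
      5 * (n * n)       ≤⟨ *-monoʳ-≤ 5 n²≤1+4F ⟩
      5 * (1 + 4 * F)   ≡⟨ eq F ⟩
      5 + 20 * F        ≤⟨ +-monoˡ-≤ (20 * F) 5≤F ⟩
      F + 20 * F        ∎
      where
      eq : ∀ F → 5 * (1 + 4 * F) ≡ 5 + 20 * F
      eq = solve-∀
    eq₁ : ∀ a → 125 * (17 * (a * a * a)) ≡ 17 * (5 * a * (5 * a) * (5 * a))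
    eq₁ = solve-∀
    eq₂ : ∀ F → 17 * (21 * F * (21 * F) * (21 * F)) ≡ 157437 * (F * F * F)
    eq₂ = solve-∀

  XY²≤4F³ : ∀ {f} → m * m ≤ 1 + 4 * f →
            let F = s * s + s * m + f in X * (Y * Y) ≤ 4 * (F * F * F)
  XY²≤4F³ {f} m²≤1+4f with <-≤-connex s 1
  ... | inj₁ s<1 = ≤-trans (≤-reflexive (cong (λ t → t * (t + k) * (Y * Y)) (n<1⇒n≡0 s<1))) z≤n
  ... | inj₂ 1≤s with <-≤-connex q (3 * suc s)
  ...   | inj₁ q<3S = amgm {X} {Y} {s * s + s * m + f} (X+Y≤3F {f} 1≤s q<3S m²≤1+4f)
  ...   | inj₂ 3S≤q = XY²≤4F³-large {s * s + s * m + f} 1≤s 3S≤q (begin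
    n * n                             ≡⟨ eq₁ s m ⟩
    4 * (s * s + s * m) + m * m       ≤⟨ +-monoʳ-≤ (4 * (s * s + s * m)) m²≤1+4f ⟩
    4 * (s * s + s * m) + (1 + 4 * f) ≡⟨ eq₂ (s * s + s * m) f ⟩
    1 + 4 * (s * s + s * m + f)       ∎)
    where
    eq₁ : ∀ s m → (2 * s + m) * (2 * s + m) ≡ 4 * (s * s + s * m) + m * m
    eq₁ = solve-∀
    eq₂ : ∀ a f → 4 * a + (1 + 4 * f) ≡ 1 + 4 * (a + f)
    eq₂ = solve-∀

product≤F³ : ∀ {s k q f a b c} → a ≤ s * (s + k) →
                b + c + q ≤ 2 * (s * s) + 2 * (s * (k + q)) + (2 * (k * q) + q * q) →
                (k + q) * (k + q) ≤ 1 + 4 * f →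
                let F = s * s + s * (k + q) + f in a * b * c ≤ F * F * F
product≤F³ {s} {k} {q} {f} {a} {b} {c} a≤X Y-bound m²≤1+4f = *-cancelˡ-≤ 4 (begin
  4 * (a * b * c)                       ≡⟨ eq a b c ⟩
  a * (4 * (b * c))                     ≤⟨ *-mono-≤ a≤X (4ab≤[a+b]² b c) ⟩
  s * (s + k) * ((b + c) * (b + c))     ≤⟨ XY²≤4F³ {s} {k} {q} {b + c} Y-bound {f} m²≤1+4f ⟩
  4 * (F * F * F)                       ∎)
  where
  F = s * s + s * (k + q) + f
  eq : ∀ a b c → 4 * (a * b * c) ≡ a * (4 * (b * c))
  eq = solve-∀

-- f below is ⌊m²/4⌋.
quarter-square : ∀ m → ∃[ f ] (4 * f ≤ m * m × m * m ≤ 1 + 4 * f)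
quarter-square 0 = 0 , z≤n , z≤n
quarter-square 1 = 0 , z≤n , ≤-refl
quarter-square (suc (suc m)) with f , 4f≤m² , m²≤1+4f ← quarter-square m =
  f + suc m , lower , upper
  where
  eq₁ : ∀ f m → 4 * (f + (1 + m)) ≡ 4 * f + 4 * (1 + m)
  eq₁ = solve-∀
  eq₂ : ∀ m → (2 + m) * (2 + m) ≡ m * m + 4 * (1 + m)
  eq₂ = solve-∀
  lower : 4 * (f + suc m) ≤ (2 + m) * (2 + m)
  lower = begin
    4 * (f + suc m)         ≡⟨ eq₁ f m ⟩
    4 * f + 4 * suc m       ≤⟨ +-monoˡ-≤ _ 4f≤m² ⟩
    m * m + 4 * suc m       ≡⟨ eq₂ m ⟨
    (2 + m) * (2 + m)       ∎
  upper : (2 + m) * (2 + m) ≤ 1 + 4 * (f + suc m)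
  upper = begin
    (2 + m) * (2 + m)       ≡⟨ eq₂ m ⟩
    m * m + 4 * suc m       ≤⟨ +-monoˡ-≤ _ m²≤1+4f ⟩
    1 + 4 * f + 4 * suc m   ≡⟨ cong suc (eq₁ f m) ⟨
    1 + 4 * (f + suc m)     ∎

-- Since n² = 4 (s² + s m) + m² with m = k + q, replacing m² by 4 f ≤ m² shows that 4 `F` ≤ n², so
-- `F` is at most the rounded quotient.
product≤[n²/4]³ : ∀ {n s k q a b c} → n ≡ 2 * s + (k + q) → a ≤ s * (s + k) →
                 b + c + q ≤ 2 * (s * s) + 2 * (s * (k + q)) + (2 * (k * q) + q * q) →
                 a * b * c ≤ (n ^ 2 / 4) ^ 3
product≤[n²/4]³ {n} {s} {k} {q} {a} {b} {c} n≡ a≤X Y-bound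
  with f , 4f≤m² , m²≤1+4f ← quarter-square (k + q) = begin
  a * b * c               ≤⟨ product≤F³ {s} {k} {q} {f} {a} {b} {c} a≤X Y-bound m²≤1+4f ⟩
  F * F * F               ≤⟨ cube-mono-≤ F≤n²/4 ⟩
  n² * n² * n²            ≡⟨ eq n² ⟩
  n² ^ 3                  ∎
  where
  F = s * s + s * (k + q) + f
  n² = n ^ 2 / 4
  eq : ∀ a → a * a * a ≡ a * (a * (a * 1))
  eq = solve-∀
  eq₁ : ∀ s m f → (s * s + s * m + f) * 4 ≡ 4 * (s * s + s * m) + 4 * f
  eq₁ = solve-∀
  eq₂ : ∀ s m → 4 * (s * s + s * m) + m * m ≡ (2 * s + m) * ((2 * s + m) * 1)
  eq₂ = solve-∀
  F≤n²/4 : F ≤ n²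
  F≤n²/4 = begin
    F             ≡⟨ m*n/n≡m F 4 ⟨
    F * 4 / 4     ≤⟨ /-monoˡ-≤ 4 (begin
      F * 4                                       ≡⟨ eq₁ s (k + q) f ⟩
      4 * (s * s + s * (k + q)) + 4 * f           ≤⟨ +-monoʳ-≤ (4 * (s * s + s * (k + q))) 4f≤m² ⟩
      4 * (s * s + s * (k + q)) + (k + q) * (k + q) ≡⟨ eq₂ s (k + q) ⟩
      (2 * s + (k + q)) ^ 2                       ≡⟨ cong (_^ 2) n≡ ⟨
      n ^ 2                                       ∎) ⟩
    n ^ 2 / 4     ∎

-- Counting in lists of vertices

#filter : {P : Pred V ℓ} → Decidable P → List V → ℕ
#filter P? L = length (filter P? L)

#filter-∷ : {P : Pred V ℓ} (P? : Decidable P) → ∀ x L → #filter P? (x ∷ L) ≤ suc (#filter P? L)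
#filter-∷ P? x L with P? x
... | yes _ = ≤-refl
... | no _  = n≤1+n _

#filter-none : {P : Pred V ℓ} (P? : Decidable P) → ∀ {L} → ¬ Any P L → #filter P? L ≡ 0
#filter-none P? ¬any = cong length (filter-none P? (¬Any⇒All¬ _ ¬any))

#filter-++ : {P : Pred V ℓ} (P? : Decidable P) → ∀ K L → #filter P? (K ++ L) ≡ #filter P? K + #filter P? L
#filter-++ P? K L = trans (cong length (filter-++ P? K L)) (length-++ (filter P? K))

#filter-disjoint : {P : Pred V ℓ} {Q : Pred V ℓ′} (P? : Decidable P) (Q? : Decidable Q) →
                   (∀ {x} → P x → Q x → ⊥) → ∀ L → #filter P? L + #filter Q? L ≤ length L
#filter-disjoint P? Q? disjoint [] = z≤n
#filter-disjoint P? Q? disjoint (x ∷ L) with ih ← #filter-disjoint P? Q? disjoint L | P? x | Q? x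
... | yes Px | yes Qx = contradiction Qx (disjoint Px)
... | yes _  | no _   = s≤s ih
... | no _   | yes _  = ≤-trans (≤-reflexive (+-suc _ _)) (s≤s ih)
... | no _   | no _   = m≤n⇒m≤1+n ih

#filter-complement : {P : Pred V ℓ} (P? : Decidable P) →
                     ∀ L → #filter P? L + #filter (¬? ∘ P?) L ≡ length L
#filter-complement P? [] = refl
#filter-complement P? (x ∷ L) with ih ← #filter-complement P? L | P? x
... | yes _ = cong suc ih
... | no _  = trans (+-suc _ _) (cong suc ih)

∈⇒↭∷ : ∀ {x : V} {L} → x ∈ˡ L → ∃[ L′ ] L ↭ x ∷ L′
∈⇒↭∷ x∈L with K , K′ , refl ← ∈-∃++ x∈L = K ++ K′ , shift _ K K′

Any⇒↭∷ : {P : Pred V ℓ} → ∀ {L} → Any P L → ∃[ x ] ∃[ L′ ] (P x × L ↭ x ∷ L′)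
Any⇒↭∷ any with x , x∈L , Px ← find any with L′ , L↭ ← ∈⇒↭∷ x∈L = x , L′ , Px , L↭

edgeCount : {A : Rel V ℓ} → Decidable₂ A → List V → ℕ
edgeCount A? []      = 0
edgeCount A? (x ∷ L) = #filter (A? x) L + edgeCount A? L

-- The set `P` is independent, so an entry in `P` has at most q later neighbours, while any other
-- entry has at most all k + q later ones. This sums to k q + q (q - 1) / 2; doubling and moving q
-- to the left avoids division and subtraction.
edgeCount-sparse : {A : Rel V ℓ} (A? : Decidable₂ A) {P : Pred V ℓ′} (P? : Decidable P) →
                   (∀ {x y} → P x → P y → ¬ A x y) →
                   ∀ L → let k = #filter P? L; q = #filter (¬? ∘ P?) L in
                   2 * edgeCount A? L + q ≤ 2 * (k * q) + q * q
edgeCount-sparse A? P? indep [] = z≤n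
edgeCount-sparse A? P? indep (x ∷ L) with ih ← edgeCount-sparse A? P? indep L | P? x
... | yes Px = begin
  2 * (deg + e) + q             ≡⟨ eq₁ deg e q ⟩
  2 * deg + (2 * e + q)         ≤⟨ +-mono-≤ (*-monoʳ-≤ 2 deg≤q) ih ⟩
  2 * q + (2 * (k * q) + q * q) ≡⟨ eq₂ k q ⟩
  2 * (suc k * q) + q * q       ∎
  where
  deg = #filter (A? x) L
  e = edgeCount A? L
  k = #filter P? L
  q = #filter (¬? ∘ P?) L
  deg≤q : deg ≤ q
  deg≤q = +-cancelˡ-≤ k _ _ (begin
    k + deg   ≤⟨ #filter-disjoint P? (A? x) (indep Px) L ⟩
    length L  ≡⟨ #filter-complement P? L ⟨
    k + q     ∎)
  eq₁ : ∀ d e q → 2 * (d + e) + q ≡ 2 * d + (2 * e + q)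
  eq₁ = solve-∀
  eq₂ : ∀ k q → 2 * q + (2 * (k * q) + q * q) ≡ 2 * (suc k * q) + q * q
  eq₂ = solve-∀
... | no _ = begin
  2 * (deg + e) + suc q                     ≡⟨ eq₁ deg e q ⟩
  2 * deg + (2 * e + q) + 1                 ≤⟨ +-monoˡ-≤ 1 (+-mono-≤ (*-monoʳ-≤ 2 deg≤k+q) ih) ⟩
  2 * (k + q) + (2 * (k * q) + q * q) + 1   ≡⟨ eq₂ k q ⟩
  2 * (k * suc q) + suc q * suc q           ∎
  where
  deg = #filter (A? x) L
  e = edgeCount A? L
  k = #filter P? L
  q = #filter (¬? ∘ P?) L
  deg≤k+q : deg ≤ k + q
  deg≤k+q = ≤-trans (length-filter (A? x) L) (≤-reflexive (sym (#filter-complement P? L)))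
  eq₁ : ∀ d e q → 2 * (d + e) + suc q ≡ 2 * d + (2 * e + q) + 1
  eq₁ = solve-∀
  eq₂ : ∀ k q → 2 * (k + q) + (2 * (k * q) + q * q) + 1 ≡ 2 * (k * suc q) + suc q * suc q
  eq₂ = solve-∀

edgeCount-quadratic : {A : Rel V ℓ} (A? : Decidable₂ A) →
                      ∀ L → 2 * edgeCount A? L + length L ≤ length L * length L
edgeCount-quadratic A? L = subst₂ (λ k q → 2 * edgeCount A? L + q ≤ 2 * (k * q) + q * q)
  k≡0 q≡length (edgeCount-sparse A? ∅? (λ ()) L)
  where
  k≡0 : #filter ∅? L ≡ 0
  k≡0 = #filter-none ∅? {L} (proj₂ ∘ satisfied)
  q≡length : #filter (¬? ∘ ∅?) L ≡ length L
  q≡length = trans (cong (_+ #filter (¬? ∘ ∅?) L) (sym k≡0)) (#filter-complement ∅? L)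

-- Matchings and their augmentation

flatten : List (V × V) → List V
flatten []            = []
flatten ((u , v) ∷ M) = u ∷ v ∷ flatten M

length-flatten : (M : List (V × V)) → length (flatten M) ≡ 2 * length M
length-flatten []      = refl
length-flatten (_ ∷ M) = trans (cong (2 +_) (length-flatten M)) (sym (*-distribˡ-+ 2 1 (length M)))

module NestedTriple
  {V : Set a} {A₁ A₂ A₃ : Rel V ℓ}
  (A₁? : Decidable₂ A₁) (A₂? : Decidable₂ A₂) (A₃? : Decidable₂ A₃)
  (A₁⇒A₂ : ∀ {x y} → A₁ x y → A₂ x y) (A₂⇒A₃ : ∀ {x y} → A₂ x y → A₃ x y)
  (A₁-sym : Symmetric A₁)
  (rainbow-free : ∀ {u v x} → A₁ u v → A₂ u x → A₃ v x → ⊥)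
  where

  -- Disjointness of the pairs is carried by the permutations between a vertex list and
  -- `flatten M ++ R`: each entry is used once, in a pair or in the remainder.
  IsMatching : List (V × V) → Set _
  IsMatching = All (uncurry A₁)

  OneSided : List V → V × V → Set _
  OneSided R (u , v) = ¬ Any (A₁ u) R ⊎ ¬ Any (A₁ v) R

  Improvement : List (V × V) → List V → Set _
  Improvement M R = ∃[ M′ ] ∃[ R′ ]
    (IsMatching M′ × length R′ < length R × flatten M ++ R ↭ flatten M′ ++ R′)

  two-fewer : ∀ {R R′} {x y : V} → R ↭ x ∷ y ∷ R′ → length R′ < length R
  two-fewer R↭ = ≤-trans (n≤1+n _) (≤-reflexive (sym (↭-length R↭)))

  edgeless-or-edge : ∀ R → edgeCount A₁? R ≡ 0 ⊎ ∃[ x ] ∃[ y ] ∃[ R′ ] (A₁ x y × R ↭ x ∷ y ∷ R′)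
  edgeless-or-edge [] = inj₁ refl
  edgeless-or-edge (x ∷ R) with any? (A₁? x) R
  ... | yes any with y , R′ , x~y , R↭ ← Any⇒↭∷ any = inj₂ (x , y , R′ , x~y , ↭-prep x R↭)
  ... | no ¬any with edgeless-or-edge R
  ...   | inj₁ e≡0 = inj₁ (cong₂ _+_ (#filter-none (A₁? x) ¬any) e≡0)
  ...   | inj₂ (y , z , R′ , y~z , R↭) =
    inj₂ (y , z , x ∷ R′ , y~z ,
      ↭-trans (↭-prep x R↭) (↭-trans (↭-swap x y ↭-refl) (↭-prep y (↭-swap x z ↭-refl))))

  -- Neighbours x of u and y of v at distinct positions of R form the
  -- augmenting path x u v y; at a common position they form a triangle.
  augment : ∀ {u v R} → A₁ u v → OneSided R (u , v)
          ⊎ ∃[ x ] ∃[ y ] ∃[ R′ ] (A₁ u x × A₁ v y × R ↭ x ∷ y ∷ R′)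
  augment {u} {v} {R} u~v with any? (A₁? u) R | any? (A₁? v) R
  ... | no ¬any | _ = inj₁ (inj₁ ¬any)
  ... | yes _ | no ¬any = inj₁ (inj₂ ¬any)
  ... | yes anyᵘ | yes anyᵛ
    with x , R′ , u~x , R↭ ← Any⇒↭∷ anyᵘ
    with Any-resp-↭ R↭ anyᵛ
  ...   | here v~x = contradiction (A₂⇒A₃ (A₁⇒A₂ v~x)) (rainbow-free u~v (A₁⇒A₂ u~x))
  ...   | there anyᵛ′ with y , R″ , v~y , R′↭ ← Any⇒↭∷ anyᵛ′ =
    inj₂ (x , y , R″ , u~x , v~y , ↭-trans R↭ (↭-prep x R′↭))

  one-sided-or-improvement : ∀ {M} → IsMatching M → ∀ R → All (OneSided R) M ⊎ Improvement M R
  one-sided-or-improvement [] R = inj₁ []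
  one-sided-or-improvement {(u , v) ∷ M} (u~v ∷ M-matching) R with augment {R = R} u~v
  ... | inj₂ (x , y , R′ , u~x , v~y , R↭) =
    -- The augmenting path x u v y trades the pair uv for the two pairs ux and vy.
    inj₂ ((u , x) ∷ (v , y) ∷ M , R′ , u~x ∷ v~y ∷ M-matching , two-fewer R↭ , ↭-prep u perm)
    where
    perm : v ∷ flatten M ++ R ↭ x ∷ v ∷ y ∷ flatten M ++ R′
    perm = ↭-trans (↭-prep v (↭-trans (++⁺ˡ (flatten M) R↭)
                     (↭-trans (shift x (flatten M) (y ∷ R′)) (↭-prep x (shift y (flatten M) R′)))))
                   (↭-swap v x ↭-refl)
  ... | inj₁ uv-one-sided with one-sided-or-improvement M-matching R
  ...   | inj₁ M-one-sided = inj₁ (uv-one-sided ∷ M-one-sided)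
  ...   | inj₂ (M′ , R′ , M′-matching , R′<R , perm) =
    inj₂ ((u , v) ∷ M′ , R′ , u~v ∷ M′-matching , R′<R , ↭-prep u (↭-prep v perm))

  extremal-or-improvement : ∀ {M} → IsMatching M → ∀ R →
    (edgeCount A₁? R ≡ 0 × All (OneSided R) M) ⊎ Improvement M R
  extremal-or-improvement {M} M-matching R with edgeless-or-edge R | one-sided-or-improvement M-matching R
  ... | inj₁ e≡0 | inj₁ one-sided   = inj₁ (e≡0 , one-sided)
  ... | _        | inj₂ improvement = inj₂ improvement
  ... | inj₂ (x , y , R′ , x~y , R↭) | _ =
    inj₂ ((x , y) ∷ M , R′ , x~y ∷ M-matching , two-fewer R↭ ,
      ↭-trans (++⁺ˡ (flatten M) R↭)
        (↭-trans (shift x (flatten M) (y ∷ R′)) (↭-prep x (shift y (flatten M) R′))))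

  -- Starting from the empty matching, every improvement shortens the unmatched list, so the process
  -- ends by well-founded induction on its length.
  extremal-matching : ∀ L → ∃[ M ] ∃[ R ]
    (IsMatching M × edgeCount A₁? R ≡ 0 × All (OneSided R) M × L ↭ flatten M ++ R)
  extremal-matching L = go [] L [] (<-wellFounded _)
    where
    go : ∀ M R → IsMatching M → Acc _<_ (length R) → ∃[ M′ ] ∃[ R′ ]
         (IsMatching M′ × edgeCount A₁? R′ ≡ 0 × All (OneSided R′) M′ × flatten M ++ R ↭ flatten M′ ++ R′)
    go M R M-matching (acc rs) with extremal-or-improvement M-matching R
    ... | inj₁ (e≡0 , one-sided) = M , R , M-matching , e≡0 , one-sided , ↭-refl
    ... | inj₂ (M′ , R′ , M′-matching , R′<R , perm)
      with M″ , R″ , M″-matching , e≡0 , one-sided , perm′ ← go M′ R′ M′-matching (rs R′<R) =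
      M″ , R″ , M″-matching , e≡0 , one-sided , ↭-trans perm perm′

  -- Degrees into the unmatched vertices

  Sparse : ℕ → ℕ → List V → Set _
  Sparse k q R = 2 * edgeCount A₂? R + q ≤ 2 * (k * q) + q * q
               × 2 * edgeCount A₃? R + q ≤ 2 * (k * q) + q * q

  PairDegree≤ : ℕ → List V → V × V → Set _
  PairDegree≤ k R (u , v) = #filter (A₁? u) R + #filter (A₁? v) R ≤ k

  larger-degree : ∀ {R u v} → OneSided R (u , v) → ∃[ w ] PairDegree≤ (#filter (A₁? w) R) R (u , v)
  larger-degree {u = u} {v} (inj₁ ¬any) = v , ≤-reflexive (cong (_+ _) (#filter-none (A₁? u) ¬any))
  larger-degree {u = u} {v} (inj₂ ¬any) =
    u , ≤-reflexive (trans (cong (_ +_) (#filter-none (A₁? v) ¬any)) (+-identityʳ _))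

  -- If ux and uy lie in G₁, then uy also lies in G₂, and an edge xy of G₃ would complete a rainbow
  -- triangle. Hence the neighbourhood is independent in G₃ and in its subgraph G₂.
  neighbourhood-sparse : ∀ u R → Sparse (#filter (A₁? u) R) (#filter (¬? ∘ A₁? u) R) R
  neighbourhood-sparse u R =
      edgeCount-sparse A₂? (A₁? u) (λ u~x u~y x~y → indep u~x u~y (A₂⇒A₃ x~y)) R
    , edgeCount-sparse A₃? (A₁? u) indep R
    where
    indep : ∀ {x y} → A₁ u x → A₁ u y → ¬ A₃ x y
    indep u~x u~y = rainbow-free u~x (A₁⇒A₂ u~y)

  trivially-sparse : ∀ R → Sparse 0 (length R) R
  trivially-sparse R = edgeCount-quadratic A₂? R , edgeCount-quadratic A₃? R

  -- One number `k` has to serve both bounds: it dominates every pair degree and is itself the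
  -- degree of a single vertex, whose neighbourhood gives sparsity. The default k = 0 and q = |R|
  -- rests on the bound valid for any list.
  max-degree : ∀ {R M} → All (OneSided R) M → ∃[ k ] ∃[ q ]
    (k + q ≡ length R × All (PairDegree≤ k R) M × Sparse k q R)
  max-degree {R} [] = 0 , length R , refl , [] , trivially-sparse R
  max-degree {R} {(u , v) ∷ M} (uv-one-sided ∷ one-sided)
    with w , uv≤w ← larger-degree uv-one-sided
       | k , q , k+q≡m , M≤k , sparse ← max-degree one-sided
    with ≤-total k (#filter (A₁? w) R)
  ... | inj₁ k≤w = _ , _ , #filter-complement (A₁? w) R
                 , uv≤w ∷ All.map (λ uv≤k → ≤-trans uv≤k k≤w) M≤k , neighbourhood-sparse w R
  ... | inj₂ w≤k = k , q , k+q≡m , ≤-trans uv≤w w≤k ∷ M≤k , sparse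

  -- Edge counts along the matching

  matched-degrees : ∀ {u v} → A₁ u v → ∀ L →
    #filter (A₁? u) L + #filter (A₁? v) L ≤ length L ×
    #filter (A₂? u) L + #filter (A₃? v) L ≤ length L ×
    #filter (A₃? u) L + #filter (A₂? v) L ≤ length L
  matched-degrees {u} {v} u~v L =
      -- A common neighbour x in the two filtered lists would close a rainbow triangle over uv; the
      -- third case reads the matched edge as vu.
      #filter-disjoint (A₁? u) (A₁? v) (λ u~x v~x → rainbow-free u~v (A₁⇒A₂ u~x) (A₂⇒A₃ (A₁⇒A₂ v~x))) L
    , #filter-disjoint (A₂? u) (A₃? v) (rainbow-free u~v) L
    , #filter-disjoint (A₃? u) (A₂? v) (λ u~x v~x → rainbow-free (A₁-sym u~v) v~x u~x) L

  edgeCount₁-bound : ∀ {R k} → edgeCount A₁? R ≡ 0 → ∀ {M} → IsMatching M → All (PairDegree≤ k R) M →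
                     edgeCount A₁? (flatten M ++ R) ≤ length M * (length M + k)
  edgeCount₁-bound e≡0 [] [] = ≤-reflexive e≡0
  edgeCount₁-bound {R} {k} e≡0 {(u , v) ∷ M} (u~v ∷ matching) (uv≤k ∷ M≤k) = begin
    #filter (A₁? u) (v ∷ F ++ R) + (#filter (A₁? v) (F ++ R) + edgeCount A₁? (F ++ R))
      ≤⟨ +-mono-≤ (#filter-∷ (A₁? u) v (F ++ R)) (+-monoʳ-≤ _ (edgeCount₁-bound e≡0 matching M≤k)) ⟩
    suc (#filter (A₁? u) (F ++ R)) + (#filter (A₁? v) (F ++ R) + s * (s + k))
      ≡⟨ cong₂ (λ d d′ → suc d + (d′ + s * (s + k))) (#filter-++ (A₁? u) F R) (#filter-++ (A₁? v) F R) ⟩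
    suc (#filter (A₁? u) F + #filter (A₁? u) R) + (#filter (A₁? v) F + #filter (A₁? v) R + s * (s + k))
      ≡⟨ eq₁ (#filter (A₁? u) F) (#filter (A₁? u) R) (#filter (A₁? v) F) (#filter (A₁? v) R) _ ⟩
    suc ((#filter (A₁? u) F + #filter (A₁? v) F) + (#filter (A₁? u) R + #filter (A₁? v) R) + s * (s + k))
      -- The pair uv contributes 1 for its own edge, at most 2 s edges to the other matched vertices
      -- and at most k to `R`: the increment from s (s + k) to (s + 1) (s + 1 + k).
      ≤⟨ s≤s (+-monoˡ-≤ _ (+-mono-≤ (proj₁ (matched-degrees u~v F)) uv≤k)) ⟩
    suc (length F + k + s * (s + k))
      ≡⟨ cong (λ l → suc (l + k + s * (s + k))) (length-flatten M) ⟩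
    suc (2 * s + k + s * (s + k))
      ≡⟨ eq₂ s k ⟩
    suc s * (suc s + k) ∎
    where
    F = flatten M
    s = length M
    eq₁ : ∀ a b c d e → suc (a + b) + (c + d + e) ≡ suc ((a + c) + (b + d) + e)
    eq₁ = solve-∀
    eq₂ : ∀ s k → suc (2 * s + k + s * (s + k)) ≡ suc s * (suc s + k)
    eq₂ = solve-∀

  edgeCount₂₃-bound : ∀ R {M} → IsMatching M → let s = length M; L = flatten M ++ R in
    edgeCount A₂? L + edgeCount A₃? L
      ≤ 2 * (s * s) + 2 * (s * length R) + (edgeCount A₂? R + edgeCount A₃? R)
  edgeCount₂₃-bound R [] = ≤-refl
  edgeCount₂₃-bound R {(u , v) ∷ M} (u~v ∷ matching)
    with _ , d₂₃≤ , d₃₂≤ ← matched-degrees u~v (flatten M ++ R) = begin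
    (#filter (A₂? u) (v ∷ L) + (#filter (A₂? v) L + edgeCount A₂? L))
      + (#filter (A₃? u) (v ∷ L) + (#filter (A₃? v) L + edgeCount A₃? L))
      ≤⟨ +-mono-≤ (+-monoˡ-≤ _ (#filter-∷ (A₂? u) v L)) (+-monoˡ-≤ _ (#filter-∷ (A₃? u) v L)) ⟩
    (suc (#filter (A₂? u) L) + (#filter (A₂? v) L + edgeCount A₂? L))
      + (suc (#filter (A₃? u) L) + (#filter (A₃? v) L + edgeCount A₃? L))
      ≡⟨ eq₁ (#filter (A₂? u) L) (#filter (A₂? v) L) (edgeCount A₂? L)
             (#filter (A₃? u) L) (#filter (A₃? v) L) (edgeCount A₃? L) ⟩
    2 + ((#filter (A₂? u) L + #filter (A₃? v) L) + (#filter (A₃? u) L + #filter (A₂? v) L)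
      + (edgeCount A₂? L + edgeCount A₃? L))
      -- The four degrees are paired crosswise, G₂ at one end with G₃ at the other, since only such
      -- pairs have disjoint neighbourhoods. The 2 allows for uv itself in both graphs.
      ≤⟨ +-monoʳ-≤ 2 (+-mono-≤ (+-mono-≤ d₂₃≤ d₃₂≤) (edgeCount₂₃-bound R matching)) ⟩
    2 + (length L + length L + (2 * (s * s) + 2 * (s * m) + e))
      ≡⟨ cong (λ l → 2 + (l + l + (2 * (s * s) + 2 * (s * m) + e)))
              (trans (length-++ (flatten M)) (cong (_+ m) (length-flatten M))) ⟩
    2 + ((2 * s + m) + (2 * s + m) + (2 * (s * s) + 2 * (s * m) + e))
      ≡⟨ eq₂ s m e ⟩
    2 * (suc s * suc s) + 2 * (suc s * m) + e ∎
    where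
    L = flatten M ++ R
    s = length M
    m = length R
    e = edgeCount A₂? R + edgeCount A₃? R
    eq₁ : ∀ a b c d e f → (suc a + (b + c)) + (suc d + (e + f)) ≡ 2 + ((a + e) + (d + b) + (c + f))
    eq₁ = solve-∀
    eq₂ : ∀ s m e → 2 + ((2 * s + m) + (2 * s + m) + (2 * (s * s) + 2 * (s * m) + e))
                  ≡ 2 * (suc s * suc s) + 2 * (suc s * m) + e
    eq₂ = solve-∀

  sparse-sum : ∀ {k q} R → Sparse k q R → edgeCount A₂? R + edgeCount A₃? R + q ≤ 2 * (k * q) + q * q
  sparse-sum {k} {q} R (sparse₂ , sparse₃) = *-cancelˡ-≤ 2 (begin
    2 * (e₂ + e₃ + q)                                 ≡⟨ eq₁ e₂ e₃ q ⟩
    (2 * e₂ + q) + (2 * e₃ + q)                       ≤⟨ +-mono-≤ sparse₂ sparse₃ ⟩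
    (2 * (k * q) + q * q) + (2 * (k * q) + q * q)     ≡⟨ eq₂ (2 * (k * q) + q * q) ⟩
    2 * (2 * (k * q) + q * q)                         ∎)
    where
    e₂ = edgeCount A₂? R
    e₃ = edgeCount A₃? R
    eq₁ : ∀ a b q → 2 * (a + b + q) ≡ (2 * a + q) + (2 * b + q)
    eq₁ = solve-∀
    eq₂ : ∀ a → a + a ≡ 2 * a
    eq₂ = solve-∀

  -- The counts are computed by peeling off matched pairs from the front, so the bound is stated for
  -- the rearrangement `L′` that lists those pairs first.
  edgeCount-product : ∀ L → ∃[ L′ ] (L ↭ L′ ×
    edgeCount A₁? L′ * edgeCount A₂? L′ * edgeCount A₃? L′ ≤ (length L ^ 2 / 4) ^ 3)
  edgeCount-product L
    with M , R , matching , e≡0 , one-sided , L↭ ← extremal-matching L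
    with k , q , k+q≡m , M≤k , sparse ← max-degree one-sided =
    flatten M ++ R , L↭ , product≤[n²/4]³ {s = length M} {k} {q} length-L
      (edgeCount₁-bound e≡0 matching M≤k) (begin
        edgeCount A₂? L′ + edgeCount A₃? L′ + q
          ≤⟨ +-monoˡ-≤ q (edgeCount₂₃-bound R matching) ⟩
        c + 2 * (s * length R) + (edgeCount A₂? R + edgeCount A₃? R) + q
          ≡⟨ +-assoc (c + 2 * (s * length R)) _ q ⟩
        c + 2 * (s * length R) + (edgeCount A₂? R + edgeCount A₃? R + q)
          ≤⟨ +-monoʳ-≤ (c + 2 * (s * length R)) (sparse-sum {k} R sparse) ⟩
        c + 2 * (s * length R) + (2 * (k * q) + q * q)
          ≡⟨ cong (λ m → c + 2 * (s * m) + (2 * (k * q) + q * q)) k+q≡m ⟨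
        c + 2 * (s * (k + q)) + (2 * (k * q) + q * q) ∎)
    where
    L′ = flatten M ++ R
    s = length M
    c = 2 * (s * s)
    length-L : length L ≡ 2 * s + (k + q)
    length-L = trans (↭-length L↭) (trans (length-++ (flatten M)) (cong₂ _+_ (length-flatten M) (sym k+q≡m)))

-- Edges and graphs

Any-─ : {P : Pred A ℓ} {Q : Pred A ℓ′} → ∀ {xs} (p : Any P xs) → ¬ Q (Any.lookup p) → Any Q xs → Any Q (xs ─ p)
Any-─ (here _)  ¬Q (here q)  = contradiction q ¬Q
Any-─ (here _)  ¬Q (there q) = q
Any-─ (there p) ¬Q (here q)  = here q
Any-─ (there p) ¬Q (there q) = there (Any-─ p ¬Q q)

-- A pigeonhole argument: separated elements never share a partner, so deleting the partner of the
-- head from `ys` keeps a partner for every element of the tail.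
length-≤-by-separation : {R : REL A B ℓ} {_#_ : A → A → Set ℓ′} →
  (∀ {x x′ y} → x # x′ → R x y → ¬ R x′ y) →
  ∀ {xs ys} → AllPairs _#_ xs → All (λ x → Any (R x) ys) xs → length xs ≤ length ys
length-≤-by-separation sep [] [] = z≤n
length-≤-by-separation {R = R} sep {x ∷ xs} {ys} (x# ∷ xs#) (p ∷ ps) = ≤-trans
  (s≤s (length-≤-by-separation sep xs#
    (All.zipWith (λ (x#x′ , p′) → Any-─ p (sep x#x′ (lookup-result p)) p′) (x# , ps))))
  (≤-reflexive (sym (length-removeAt′ ys (Any.index p))))

module _ {V : Set a} where

  -- The condition x ≢ y makes the two endpoints determine the edge up to `_≈_`.
  Joins : V → V → Edge V → Set a
  Joins x y E = x ≢ y × x ∈ᵛ elements E × y ∈ᵛ elements E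

  joins-endpoints : ∀ {x y z E} → Joins x y E → z ∈ᵛ elements E → z ≡ x ⊎ z ≡ y
  joins-endpoints {E = kSubset (_ ∷ _ ∷ []) _} (x≢y , here refl , here refl) _ = contradiction refl x≢y
  joins-endpoints {E = kSubset (_ ∷ _ ∷ []) _} (x≢y , there (here refl) , there (here refl)) _ = contradiction refl x≢y
  joins-endpoints {E = kSubset (_ ∷ _ ∷ []) _} (_ , here refl , there (here refl)) (here refl) = inj₁ refl
  joins-endpoints {E = kSubset (_ ∷ _ ∷ []) _} (_ , here refl , there (here refl)) (there (here refl)) = inj₂ refl
  joins-endpoints {E = kSubset (_ ∷ _ ∷ []) _} (_ , there (here refl) , here refl) (here refl) = inj₂ refl
  joins-endpoints {E = kSubset (_ ∷ _ ∷ []) _} (_ , there (here refl) , here refl) (there (here refl)) = inj₁ refl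

  joins-⊆ₖ : ∀ {x y l} {E : Edge V} {T : KSubset V l} → Joins x y E →
             x ∈ᵛ elements T → y ∈ᵛ elements T → E ⊆ₖ T
  joins-⊆ₖ {E = E} E-joins x∈T y∈T z∈E with joins-endpoints {E = E} E-joins z∈E
  ... | inj₁ refl = x∈T
  ... | inj₂ refl = y∈T

  joins-≈ : ∀ {x y} {E E′ : Edge V} → Joins x y E → Joins x y E′ → E ≈ E′
  joins-≈ {E = E} {E′} j@(_ , x∈E , y∈E) j′@(_ , x∈E′ , y∈E′) =
    joins-⊆ₖ {E = E} {E′} j x∈E′ y∈E′ , joins-⊆ₖ {E = E′} {E} j′ x∈E y∈E

  joins-sym : ∀ {x y E} → Joins x y E → Joins y x E
  joins-sym (x≢y , x∈E , y∈E) = x≢y ∘ sym , y∈E , x∈E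

  endpoints : (E : Edge V) → ∃[ x ] ∃[ y ] Joins x y E
  endpoints (kSubset (x ∷ y ∷ []) ((x≢y ∷ []) ∷ _)) = x , y , x≢y , here refl , there (here refl)

  -- An edge inside `T` has two distinct endpoints among x, y, z, and each of the six ordered
  -- choices identifies it, up to `_≈_`, with one of the three given edges.
  joins-triangle : ∀ {x y z E₁ E₂ E₃} → Joins x y E₁ → Joins x z E₂ → Joins y z E₃ → IsTriangle E₁ E₂ E₃
  joins-triangle {x} {y} {z} {E₁} {E₂} {E₃} j₁@(x≢y , _) j₂@(x≢z , _) j₃@(y≢z , _) =
    T , λ E → mk⇔ (to {E}) (from {E})
    where
    T : KSubset V 3
    T = kSubset (x ∷ y ∷ z ∷ []) ((x≢y ∷ x≢z ∷ []) ∷ (y≢z ∷ []) ∷ [] ∷ [])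
    to : ∀ {E} → Any (E ≈_) (E₁ ∷ E₂ ∷ E₃ ∷ []) → E ⊆ₖ T
    to (here E≈E₁)                 = joins-⊆ₖ {E = E₁} {T} j₁ (here refl) (there (here refl)) ∘ proj₁ E≈E₁
    to (there (here E≈E₂))         = joins-⊆ₖ {E = E₂} {T} j₂ (here refl) (there (there (here refl))) ∘ proj₁ E≈E₂
    to (there (there (here E≈E₃))) = joins-⊆ₖ {E = E₃} {T} j₃ (there (here refl)) (there (there (here refl))) ∘ proj₁ E≈E₃
    from : ∀ {E} → E ⊆ₖ T → Any (E ≈_) (E₁ ∷ E₂ ∷ E₃ ∷ [])
    from {E} E⊆T with u , v , j@(u≢v , u∈E , v∈E) ← endpoints E with E⊆T u∈E | E⊆T v∈E
    ... | here refl                 | here refl                 = contradiction refl u≢v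
    ... | there (here refl)         | there (here refl)         = contradiction refl u≢v
    ... | there (there (here refl)) | there (there (here refl)) = contradiction refl u≢v
    ... | here refl                 | there (here refl)         = here (joins-≈ {E = E} {E₁} j j₁)
    ... | there (here refl)         | here refl                 = here (joins-≈ {E = E} {E₁} (joins-sym {E = E} j) j₁)
    ... | here refl                 | there (there (here refl)) = there (here (joins-≈ {E = E} {E₂} j j₂))
    ... | there (there (here refl)) | here refl                 = there (here (joins-≈ {E = E} {E₂} (joins-sym {E = E} j) j₂))
    ... | there (here refl)         | there (there (here refl)) = there (there (here (joins-≈ {E = E} {E₃} j j₃)))
    ... | there (there (here refl)) | there (here refl)         = there (there (here (joins-≈ {E = E} {E₃} (joins-sym {E = E} j) j₃)))

  Adjacent : Graph V → V → V → Set a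
  Adjacent G x y = ∃[ E ] (E ∈ G × Joins x y E)

  adjacent? : DecidableEquality V → (G : Graph V) → Decidable₂ (Adjacent G)
  adjacent? _≟_ G x y with any? joins? (edges G)
    where
    joins? : ∀ E → Dec (Joins x y E)
    joins? E = ¬? (x ≟ y) ×-dec mem? _≟_ x (elements E) ×-dec mem? _≟_ y (elements E)
  ... | yes p = yes (ListMembership.find (edgeSetoid V) p)
  -- Membership in `G` holds only up to `_≈_`, so the endpoints are carried over to the listed edge.
  ... | no ¬p = no λ (E , E∈G , x≢y , x∈E , y∈E) →
    ¬p (Any.map (λ (E⊆E′ , _) → x≢y , E⊆E′ x∈E , E⊆E′ y∈E) E∈G)

  adjacent-sym : ∀ {G} → Symmetric (Adjacent G)
  adjacent-sym (E , E∈G , j) = E , E∈G , joins-sym {E = E} j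

  adjacent-mono : ∀ {G H} → G ⊆ H → ∀ {x y} → Adjacent G x y → Adjacent H x y
  adjacent-mono G⊆H (E , E∈G , j) = E , G⊆H {E} E∈G , j

  rainbow-free-adjacent : ∀ {G₁ G₂ G₃} → RainbowTriangleFree G₁ G₂ G₃ →
    ∀ {x y z} → Adjacent G₁ x y → Adjacent G₂ x z → Adjacent G₃ y z → ⊥
  rainbow-free-adjacent rbt (E₁ , E₁∈ , j₁) (E₂ , E₂∈ , j₂) (E₃ , E₃∈ , j₃) =
    rbt (E₁ , E₂ , E₃ , E₁∈ , E₂∈ , E₃∈ , joins-triangle {E₁ = E₁} {E₂} {E₃} j₁ j₂ j₃)

-- Comparing the size of a graph with its edge count

links : {A : V → V → Set ℓ} → Decidable₂ A → List V → List (V × V)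
links A? []      = []
links A? (x ∷ L) = map (x ,_) (filter (A? x) L) ++ links A? L

length-links : {A : V → V → Set ℓ} (A? : Decidable₂ A) → ∀ L → length (links A? L) ≡ edgeCount A? L
length-links A? []      = refl
length-links A? (x ∷ L) = trans (length-++ (map (x ,_) (filter (A? x) L)))
  (cong₂ _+_ (length-map (x ,_) (filter (A? x) L)) (length-links A? L))

∈-links : {A : V → V → Set ℓ} (A? : Decidable₂ A) → Symmetric A → ∀ {x y} → x ≢ y → A x y →
          ∀ {L} → x ∈ˡ L → y ∈ˡ L → (x , y) ∈ˡ links A? L ⊎ (y , x) ∈ˡ links A? L
∈-links A? A-sym x≢y x~y (here refl) (here refl) = contradiction refl x≢y
∈-links A? A-sym x≢y x~y {x ∷ _} (here refl) (there y∈L) =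
  inj₁ (∈-++⁺ˡ (∈-map⁺ (x ,_) (∈-filter⁺ (A? x) y∈L x~y)))
∈-links A? A-sym x≢y x~y {y ∷ _} (there x∈L) (here refl) =
  inj₂ (∈-++⁺ˡ (∈-map⁺ (y ,_) (∈-filter⁺ (A? y) x∈L (A-sym x~y))))
∈-links A? A-sym x≢y x~y {z ∷ L} (there x∈L) (there y∈L) =
  Sum.map (∈-++⁺ʳ _) (∈-++⁺ʳ _) (∈-links A? A-sym x≢y x~y x∈L y∈L)

-- Every edge is joined by some listed pair, in one of the two orders, and edges sharing a pair are
-- equal up to `_≈_`; the pigeonhole argument then compares the lengths.
∣G∣≤edgeCount : (_≟_ : DecidableEquality V) (G : Graph V) → ∀ {L} → (∀ x → x ∈ˡ L) →
                ∣ G ∣ ≤ edgeCount (adjacent? _≟_ G) L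
∣G∣≤edgeCount {V = V} _≟_ G {L} complete = ≤-trans
  (length-≤-by-separation {R = λ E p → Joins (proj₁ p) (proj₂ p) E}
    (λ {E} {E′} E≉E′ j j′ → E≉E′ (joins-≈ {E = E} {E′} j j′))
    (unique G) (All.tabulateₛ (edgeSetoid V) (λ {E} → linked {E})))
  (≤-reflexive (length-links (adjacent? _≟_ G) L))
  where
  linked : ∀ {E} → E ∈ G → Any (λ p → Joins (proj₁ p) (proj₂ p) E) (links (adjacent? _≟_ G) L)
  linked {E} E∈G with x , y , j@(x≢y , _) ← endpoints E
    with ∈-links (adjacent? _≟_ G) (adjacent-sym {G = G}) x≢y (E , E∈G , j) (complete x) (complete y)
  ... | inj₁ xy∈ = lose xy∈ j
  ... | inj₂ yx∈ = lose yx∈ (joins-sym {E = E} j)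

theorem1p5 : {a : Level} (V : Set a) (n : ℕ) → V ↔ Fin n →
    (G₁ G₂ G₃ : Graph V) → G₁ ⊆ G₂ → G₂ ⊆ G₃ →
    RainbowTriangleFree G₁ G₂ G₃ →
    ∣ G₁ ∣ * ∣ G₂ ∣ * ∣ G₃ ∣ ≤ (n ^ 2 / 4) ^ 3
theorem1p5 V n V↔Fin G₁ G₂ G₃ G₁⊆G₂ G₂⊆G₃ rbt =
  let L , L↭ , bound = edgeCount-product vertices
      -- The rearranged list still contains every vertex, which is all that the comparison of each
      -- graph with its edge count asks of it.
      complete = λ x → ∈-resp-↭ L↭ (∈-vertices x)
  in begin
  ∣ G₁ ∣ * ∣ G₂ ∣ * ∣ G₃ ∣
    ≤⟨ *-mono-≤ (*-mono-≤ (∣G∣≤edgeCount _≟_ G₁ complete) (∣G∣≤edgeCount _≟_ G₂ complete))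
                (∣G∣≤edgeCount _≟_ G₃ complete) ⟩
  edgeCount (adjacent? _≟_ G₁) L * edgeCount (adjacent? _≟_ G₂) L * edgeCount (adjacent? _≟_ G₃) L
    ≤⟨ bound ⟩
  (length vertices ^ 2 / 4) ^ 3
    ≡⟨ cong (λ m → (m ^ 2 / 4) ^ 3) length-vertices ⟩
  (n ^ 2 / 4) ^ 3 ∎
  where
  open Inverse V↔Fin using (to; from; strictlyInverseʳ)

  _≟_ : DecidableEquality V
  _≟_ = via-injection (↔⇒↣ V↔Fin) Fin._≟_

  open NestedTriple (adjacent? _≟_ G₁) (adjacent? _≟_ G₂) (adjacent? _≟_ G₃)
    (adjacent-mono {G = G₁} {G₂} (λ {E} → G₁⊆G₂ {E})) (adjacent-mono {G = G₂} {G₃} (λ {E} → G₂⊆G₃ {E}))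
    (adjacent-sym {G = G₁}) (rainbow-free-adjacent {G₁ = G₁} {G₂} {G₃} rbt)

  vertices : List V
  vertices = map from (allFin n)

  length-vertices : length vertices ≡ n
  length-vertices = trans (length-map from (allFin n)) (length-tabulate id)

  ∈-vertices : ∀ x → x ∈ˡ vertices
  ∈-vertices x = subst (_∈ˡ vertices) (strictlyInverseʳ x) (∈-map⁺ from (∈-allFin (to x)))
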